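{- Let $k\geq5$ be odd and let $d$ be an integer with $d\geq\frac{3^{k-1}}{k-1}+1$. Then $BC_{d,k}\geq 2(k-1)\left(\lfloor\frac{d}{2}\rfloor\right)^{k-1}$.
   Context: A Cayley digraph $Cay(\Gamma,X)$ of a group $\Gamma$ with respect to a generating set $X$ not containing the identity has vertex set $\Gamma$ and an arc from $u$ to $v$ iff $ux=v$ for some $x\in X$; its degree is $|X|$. It is bipartite if its vertex set can be partitioned into two parts such that every arc joins vertices in different parts. $BC_{d,k}$ denotes the largest number of vertices of a bipartite Cayley digraph of degree $d$ and diameter $k$ (diameter = maximum directed distance). -}

module Defs where

open import Data.Nat using (ℕ; _≤_; _∸_)
open import Data.Fin using (Fin)
open import Data.Fin.Subset using (Subset; _∈_; _∉_; ∣_∣)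
open import Data.List using (List; foldl; length)
open import Data.List.Relation.Unary.All using (All)
open import Data.Bool using (Bool)
open import Data.Product using (Σ; _×_; ∃; ∃-syntax)
open import Relation.Binary.PropositionalEquality using (_≡_; _≢_)
open import Relation.Nullary using (¬_)

-- A finite group of order n, with carrier Fin n (every finite group is
-- isomorphic to one of this form).
record FinGroup (n : ℕ) : Set where
  field
    _·_   : Fin n → Fin n → Fin n
    e     : Fin n
    inv   : Fin n → Fin n
    assoc : ∀ a b c → (a · b) · c ≡ a · (b · c)
    idˡ   : ∀ a → e · a ≡ a
    idʳ   : ∀ a → a · e ≡ a
    invˡ  : ∀ a → inv a · a ≡ e
    invʳ  : ∀ a → a · inv a ≡ e

module _ {n : ℕ} (G : FinGroup n) (X : Subset n) where
  open FinGroup G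

  Arc : Fin n → Fin n → Set
  Arc u v = ∃[ x ] (x ∈ X × u · x ≡ v)

  WalkOfLength : ℕ → Fin n → Fin n → Set
  WalkOfLength ℓ u v = Σ (List (Fin n)) λ w →
    length w ≡ ℓ × All (_∈ X) w × foldl _·_ u w ≡ v

  DistAtMost : ℕ → Fin n → Fin n → Set
  DistAtMost m u v = ∃[ ℓ ] (ℓ ≤ m × WalkOfLength ℓ u v)

  HasDiameter : ℕ → Set
  HasDiameter k =
    (∀ u v → DistAtMost k u v) ×
    (∃[ u ] ∃[ v ] ¬ DistAtMost (k ∸ 1) u v)

  IsBipartite : Set
  IsBipartite = Σ (Fin n → Bool) λ c → ∀ u v → Arc u v → c u ≢ c v

IsBipCayley : ℕ → ℕ → {n : ℕ} → FinGroup n → Subset n → Set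
IsBipCayley d k G X =
  FinGroup.e G ∉ X × ∣ X ∣ ≡ d × IsBipartite G X × HasDiameter G X k

BC≥ : ℕ → ℕ → ℕ → Set
BC≥ d k N = ∃[ n ] Σ (FinGroup n) λ G → ∃[ X ] (IsBipCayley d k G X × N ≤ n)

{-# OPTIONS --safe #-}
module Submission where

-- Put n = k − 1 (even) and m = ⌊d/2⌋, and take the group (ℤ_m ≀ ℤ_n) × ℤ_2 of
-- order 2 n m^n.  The generators (h at coordinate 0; s; 1) with h ∈ ℤ_m and
-- s ∈ {1, 2}, together with (0; 0; 1) when d is odd, act on (x; p; b) by changing
-- coordinate p of x, moving p to p + s and flipping b, so b is a 2-colouring.
-- Writing an end offset r < n as 2q + ρ, the n steps 2^q 1^(n−1−2q) 2^q (1+ρ)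
-- visit all of ℤ_n and lead from p to p + r; hence every vertex of the same colour is
-- reached in n steps, and every other vertex in n + 1.  Each step changes one
-- coordinate, so a vector without zero entries needs at least n steps, and
-- n + 1 if it has the opposite colour.

open import Defs
open import Algebra.Structures using (IsGroup)
open import Data.Bool using (Bool; true; false; not; _xor_)
open import Data.Bool.Properties using (xor-assoc; xor-identityʳ; xor-same; not-involutive) renaming (_≟_ to _≟ᵇ_)
open import Data.Fin using (Fin; zero; suc; toℕ)
open import Data.Fin.Properties using (toℕ-injective; suc-injective; toℕ-fromℕ<; toℕ<n; *↔×; 2↔Bool; _≟_)
open import Data.Fin.Subset using (Subset; _∈_; _∉_; ∣_∣; ⁅_⁆; _∪_; ⊥; inside; outside)
open import Data.Fin.Subset.Properties using (x∈⁅x⁆; x∈⁅y⁆⇒x≡y; x∈p∪q⁻; x∈p∪q⁺; ∪-identityˡ; ∉⊥; ∣⊥∣≡0)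
open import Data.List using (List; []; _∷_; _++_; map; foldl; foldr; length; replicate; allFin)
open import Data.List.Membership.Propositional as List using ()
open import Data.List.Membership.Propositional.Properties using (∈-map⁺; ∈-map⁻; ∈-++⁺ˡ; ∈-++⁺ʳ; ∈-++⁻; ∈-allFin)
open import Data.List.Properties using (length-map; length-++; length-replicate; foldl-++; length-tabulate)
open import Data.List.Relation.Unary.All using (All; []; _∷_; lookup)
import Data.List.Relation.Unary.All as All
import Data.List.Relation.Unary.All.Properties as All
open import Data.List.Relation.Unary.AllPairs using ([]; _∷_)
open import Data.List.Relation.Unary.Any using (here; there)
open import Data.List.Relation.Unary.Unique.Propositional using (Unique)
import Data.List.Relation.Unary.Unique.Propositional.Properties as Unique
open import Data.Nat using (ℕ; zero; suc; _+_; _≤_; _<_; _*_; _∸_; _^_; _%_; _/_; ⌊_/2⌋; NonZero; z≤n; s≤s; s≤s⁻¹; _<?_; ≢-nonZero⁻¹)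
open import Data.Nat.DivMod using (_mod_; m%n<n; %-distribˡ-+; m<n⇒m%n≡m; n%n≡0; [m+n]%n≡m%n; m≡m%n+[m/n]*n; m<n*o⇒m/o<n)
import Data.Nat.Properties as ℕ
open import Data.Nat.Tactic.RingSolver using (solve-∀)
open import Data.Product using (Σ; _×_; _,_; proj₁; proj₂; ∃-syntax)
open import Data.Product.Function.NonDependent.Propositional using (_×-↔_)
open import Data.Sum using (_⊎_; inj₁; inj₂; [_,_]′)
open import Data.Vec as Vec using (Vec; []; _∷_; tabulate; _[_]≔_; count) renaming (lookup to _!_)
open import Data.Vec.Properties using (lookup∘tabulate; tabulate∘lookup; tabulate-cong; lookup∘update; lookup∘update′; lookup-replicate)
open import Function using (_↔_; Inverse; mk↔ₛ′; _∘_; id)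
open import Function.Construct.Composition using (_↔-∘_)
open import Function.Construct.Symmetry using (↔-sym)
open import Function.Construct.Identity using (↔-id)
open import Relation.Binary.PropositionalEquality using (_≡_; _≢_; refl; sym; trans; cong; cong₂; subst; isEquivalence; module ≡-Reasoning)
open import Relation.Nullary using (¬_; yes; no; contradiction; ¬?)

-- Subsets from lists

fromList : ∀ {n} → List (Fin n) → Subset n
fromList = foldr (λ i p → ⁅ i ⁆ ∪ p) ⊥

∈-fromList⁺ : ∀ {n} {i : Fin n} {l} → i List.∈ l → i ∈ fromList l
∈-fromList⁺ {i = i} (here refl) = x∈p∪q⁺ (inj₁ (x∈⁅x⁆ i))
∈-fromList⁺ (there i∈l)         = x∈p∪q⁺ (inj₂ (∈-fromList⁺ i∈l))

∈-fromList⁻ : ∀ {n} {i : Fin n} l → i ∈ fromList l → i List.∈ l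
∈-fromList⁻ []      i∈⊥ = contradiction i∈⊥ ∉⊥
∈-fromList⁻ (j ∷ l) i∈  with x∈p∪q⁻ ⁅ j ⁆ (fromList l) i∈
... | inj₁ i∈⁅j⁆ = here (x∈⁅y⁆⇒x≡y j i∈⁅j⁆)
... | inj₂ i∈l   = there (∈-fromList⁻ l i∈l)

∣⁅i⁆∪p∣ : ∀ {n} (i : Fin n) (p : Subset n) → i ∉ p → ∣ ⁅ i ⁆ ∪ p ∣ ≡ suc ∣ p ∣
∣⁅i⁆∪p∣ zero    (inside  ∷ p) i∉p = contradiction Vec.here i∉p
∣⁅i⁆∪p∣ zero    (outside ∷ p) i∉p = cong (suc ∘ ∣_∣) (∪-identityˡ p)
∣⁅i⁆∪p∣ (suc i) (inside  ∷ p) i∉p = cong suc (∣⁅i⁆∪p∣ i p (i∉p ∘ Vec.there))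
∣⁅i⁆∪p∣ (suc i) (outside ∷ p) i∉p = ∣⁅i⁆∪p∣ i p (i∉p ∘ Vec.there)

∣fromList∣ : ∀ {n} {l : List (Fin n)} → Unique l → ∣ fromList l ∣ ≡ length l
∣fromList∣ {n}             []         = ∣⊥∣≡0 n
∣fromList∣ {l = i ∷ l} (i∉l ∷ l!) =
  trans (∣⁅i⁆∪p∣ i (fromList l) (λ i∈ → lookup i∉l (∈-fromList⁻ l i∈) refl))
        (cong suc (∣fromList∣ l!))

-- Cayley digraphs on arbitrary carriers

-- A `FinGroup` lives on `Fin N`; transporting along a bijection lets paths and colours be studied
-- on a structured carrier.
module Transport {A : Set} {N : ℕ} (iso : A ↔ Fin N)
  {_∙_ : A → A → A} {ε : A} {_⁻¹ : A → A} (isGroup : IsGroup _≡_ _∙_ ε _⁻¹) where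

  open Inverse iso using (to; from; strictlyInverseˡ; strictlyInverseʳ)
  open IsGroup isGroup using (assoc; identityˡ; identityʳ; inverseˡ; inverseʳ)

  finGroup : FinGroup N
  finGroup = record
    { _·_   = λ i j → to (from i ∙ from j)
    ; e     = to ε
    ; inv   = λ i → to (from i ⁻¹)
    ; assoc = λ i j k → cong to (begin
        from (to (from i ∙ from j)) ∙ from k ≡⟨ cong (_∙ from k) (strictlyInverseʳ _) ⟩
        (from i ∙ from j) ∙ from k           ≡⟨ assoc _ _ _ ⟩
        from i ∙ (from j ∙ from k)           ≡⟨ cong (from i ∙_) (strictlyInverseʳ _) ⟨
        from i ∙ from (to (from j ∙ from k)) ∎)
    ; idˡ   = λ i → trans (cong to (trans (cong (_∙ from i) (strictlyInverseʳ ε)) (identityˡ _))) (strictlyInverseˡ i)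
    ; idʳ   = λ i → trans (cong to (trans (cong (from i ∙_) (strictlyInverseʳ ε)) (identityʳ _))) (strictlyInverseˡ i)
    ; invˡ  = λ i → cong to (trans (cong (_∙ from i) (strictlyInverseʳ _)) (inverseˡ (from i)))
    ; invʳ  = λ i → cong to (trans (cong (from i ∙_) (strictlyInverseʳ _)) (inverseʳ (from i)))
    }
    where open ≡-Reasoning

  open FinGroup finGroup using (_·_)

  Path : List A → ℕ → A → A → Set
  Path L ℓ u v = Σ (List A) λ w → length w ≡ ℓ × All (List._∈ L) w × foldl _∙_ u w ≡ v

  foldl-to : ∀ i w → foldl _·_ i (map to w) ≡ to (foldl _∙_ (from i) w)
  foldl-to i []      = sym (strictlyInverseˡ i)
  foldl-to i (x ∷ w) = trans (foldl-to _ w)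
    (cong (λ u → to (foldl _∙_ u w)) (trans (strictlyInverseʳ _) (cong (from i ∙_) (strictlyInverseʳ x))))

  from-foldl : ∀ i w → from (foldl _·_ i w) ≡ foldl _∙_ (from i) (map from w)
  from-foldl i []      = refl
  from-foldl i (j ∷ w) = trans (from-foldl _ w)
    (cong (λ u → foldl _∙_ u (map from w)) (strictlyInverseʳ _))

  module _ (L : List A) where

    X : Subset N
    X = fromList (map to L)

    to∈X : ∀ {x} → x List.∈ L → to x ∈ X
    to∈X x∈L = ∈-fromList⁺ (∈-map⁺ to x∈L)

    from∈L : ∀ {i} → i ∈ X → from i List.∈ L
    from∈L i∈X with ∈-map⁻ to (∈-fromList⁻ (map to L) i∈X)
    ... | x , x∈L , refl = subst (List._∈ L) (sym (strictlyInverseʳ x)) x∈L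

    path⇒walk : ∀ {ℓ} i j → Path L ℓ (from i) (from j) → WalkOfLength finGroup X ℓ i j
    path⇒walk i j (w , len , w⊆L , eq) =
      map to w , trans (length-map to w) len , All.map⁺ (All.map to∈X w⊆L) ,
      trans (foldl-to i w) (trans (cong to eq) (strictlyInverseˡ j))

    walk⇒path : ∀ {ℓ} i j → WalkOfLength finGroup X ℓ i j → Path L ℓ (from i) (from j)
    walk⇒path i j (w , len , w⊆X , eq) =
      map from w , trans (length-map from w) len , All.map⁺ (All.map from∈L w⊆X) ,
      trans (sym (from-foldl i w)) (cong from eq)

    isBipCayley : ∀ {k} → Unique L →
      (c : A → Bool) → (∀ u {x} → x List.∈ L → c u ≢ c (u ∙ x)) →
      (∀ u v → ∃[ ℓ ] (ℓ ≤ k × Path L ℓ u v)) →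
      (∃[ u ] ∃[ v ] (∀ ℓ → ℓ ≤ k ∸ 1 → ¬ Path L ℓ u v)) →
      IsBipCayley (length L) k finGroup X
    isBipCayley {k} L! c c-alternates near (u , v , far) = e∉X , card , bip , diam
      where
      -- An identity generator would give a loop, whose two ends share a colour.
      e∉X : to ε ∉ X
      e∉X e∈X = c-alternates ε (from∈L e∈X)
        (cong c (sym (trans (cong (ε ∙_) (strictlyInverseʳ ε)) (identityˡ ε))))

      card : ∣ X ∣ ≡ length L
      card = trans (∣fromList∣ (Unique.map⁺ to-injective L!)) (length-map to L)
        where
        to-injective : ∀ {x y} → to x ≡ to y → x ≡ y
        to-injective eq = trans (sym (strictlyInverseʳ _)) (trans (cong from eq) (strictlyInverseʳ _))

      bip : IsBipartite finGroup X
      bip = c ∘ from , λ { i _ (x , x∈X , refl) eq →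
        c-alternates (from i) (from∈L x∈X) (trans eq (cong c (strictlyInverseʳ _))) }

      diam : HasDiameter finGroup X k
      diam = (λ i j → let ℓ , ℓ≤k , π = near (from i) (from j) in ℓ , ℓ≤k , path⇒walk i j π)
           , to u , to v , λ { (ℓ , ℓ≤ , ω) → far ℓ ℓ≤
               (subst (λ a → Path L ℓ a v) (strictlyInverseʳ u)
               (subst (Path L ℓ _) (strictlyInverseʳ v) (walk⇒path _ _ ω))) }

-- Cyclic groups

mod-cong : ∀ {a b} n .{{_ : NonZero n}} → a % n ≡ b % n → a mod n ≡ b mod n
mod-cong n eq = toℕ-injective (trans (toℕ-fromℕ< _) (trans eq (sym (toℕ-fromℕ< _))))

toℕ-mod : ∀ {n} .{{_ : NonZero n}} (i : Fin n) → toℕ i mod n ≡ i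
toℕ-mod i = toℕ-injective (trans (toℕ-fromℕ< _) (m<n⇒m%n≡m (toℕ<n i)))

module _ (n : ℕ) .{{_ : NonZero n}} where

  infixl 6 _⊕_
  _⊕_ : Fin n → Fin n → Fin n
  i ⊕ j = (toℕ i + toℕ j) mod n

  -- Reduction is additive, so each group law of ℤ_n becomes an identity of natural numbers under
  -- `_mod n`.
  mod-⊕ : ∀ a b → a mod n ⊕ b mod n ≡ (a + b) mod n
  mod-⊕ a b = mod-cong n (trans
    (cong₂ (λ x y → (x + y) % n) (toℕ-fromℕ< (m%n<n a n)) (toℕ-fromℕ< (m%n<n b n)))
    (sym (%-distribˡ-+ a b n)))

  ⊕-mod : ∀ i b → i ⊕ b mod n ≡ (toℕ i + b) mod n
  ⊕-mod i b = trans (cong (_⊕ b mod n) (sym (toℕ-mod i))) (mod-⊕ (toℕ i) b)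

  mod-⊕ˡ : ∀ a j → a mod n ⊕ j ≡ (a + toℕ j) mod n
  mod-⊕ˡ a j = trans (cong (a mod n ⊕_) (sym (toℕ-mod j))) (mod-⊕ a (toℕ j))

  cyclic : FinGroup n
  cyclic = record
    { _·_   = _⊕_
    ; e     = 0 mod n
    ; inv   = λ i → (n ∸ toℕ i) mod n
    ; assoc = λ i j k → trans (mod-⊕ˡ _ k)
        (trans (cong (_mod n) (ℕ.+-assoc (toℕ i) (toℕ j) (toℕ k))) (sym (⊕-mod i _)))
    ; idˡ   = λ i → trans (mod-⊕ˡ 0 i) (toℕ-mod i)
    ; idʳ   = λ i → trans (⊕-mod i 0) (trans (cong (_mod n) (ℕ.+-identityʳ _)) (toℕ-mod i))
    ; invˡ  = λ i → trans (mod-⊕ˡ _ i) (trans (cong (_mod n) (ℕ.m∸n+n≡m (ℕ.<⇒≤ (toℕ<n i)))) n-mod)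
    ; invʳ  = λ i → trans (⊕-mod i _) (trans (cong (_mod n) (ℕ.m+[n∸m]≡n (ℕ.<⇒≤ (toℕ<n i)))) n-mod)
    }
    where
    n-mod : n mod n ≡ 0 mod n
    n-mod = mod-cong n (trans (n%n≡0 n) (sym (m<n⇒m%n≡m (ℕ.n≢0⇒n>0 (≢-nonZero⁻¹ n)))))

-- Wreath products

vec-ext : ∀ {A : Set} {n} {x y : Vec A n} → (∀ i → x ! i ≡ y ! i) → x ≡ y
vec-ext {x = x} {y} eq = trans (sym (tabulate∘lookup x)) (trans (tabulate-cong eq) (tabulate∘lookup y))

vec↔ : ∀ m n → Vec (Fin m) n ↔ Fin (m ^ n)
vec↔ m zero    = mk↔ₛ′ (λ _ → zero) (λ _ → []) (λ { zero → refl }) (λ { [] → refl })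
vec↔ m (suc n) = ↔-sym *↔× ↔-∘ ((↔-id _ ×-↔ vec↔ m n) ↔-∘ uncons)
  where
  uncons : Vec (Fin m) (suc n) ↔ (Fin m × Vec (Fin m) n)
  uncons = mk↔ₛ′ (λ x → Vec.head x , Vec.tail x) (λ (a , x) → a ∷ x) (λ _ → refl) (λ { (_ ∷ _) → refl })

parity : ℕ → Bool
parity zero    = false
parity (suc ℓ) = not (parity ℓ)

-- Only the positions from which a step departs are listed, not the final one: a generator changes
-- the coordinate at its point of departure.
visits : ∀ {A S : Set} → (A → S → A) → A → List S → List A
visits _∙_ p []      = []
visits _∙_ p (s ∷ w) = p ∷ visits _∙_ (p ∙ s) w

module Wreath {m n : ℕ} (H : FinGroup m) (K : FinGroup n) where

  private
    module H = FinGroup H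
    module K = FinGroup K
  open H using (_·_)
  open K using () renaming (_·_ to _∘ᴷ_)

  Carrier : Set
  Carrier = Vec (Fin m) n × (Fin n × Bool)

  carrier↔ : Carrier ↔ Fin (m ^ n * (n * 2))
  carrier↔ = ↔-sym *↔× ↔-∘ (vec↔ m n ×-↔ (↔-sym *↔× ↔-∘ (↔-id _ ×-↔ ↔-sym 2↔Bool)))

  -- The vector part of the wreath product: `y` is translated by `p` along the regular action of `K`
  -- on coordinates, then multiplied pointwise.
  _✶_ : Vec (Fin m) n × Fin n → Vec (Fin m) n → Vec (Fin m) n
  (x , p) ✶ y = tabulate λ i → (x ! i) · (y ! (K.inv p ∘ᴷ i))

  _∙_ : Carrier → Carrier → Carrier
  (x , p , b) ∙ (y , q , c) = (x , p) ✶ y , p ∘ᴷ q , b xor c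

  ones : Vec (Fin m) n
  ones = Vec.replicate n H.e

  ε : Carrier
  ε = ones , K.e , false

  -- Solving `(x , p) ✶ z ≡ ones` at coordinate `p ∘ᴷ j` forces this value of `z ! j`.
  shift⁻¹ : Vec (Fin m) n → Fin n → Vec (Fin m) n
  shift⁻¹ x p = tabulate λ i → H.inv (x ! (p ∘ᴷ i))

  _⁻¹ : Carrier → Carrier
  (x , p , b) ⁻¹ = shift⁻¹ x p , K.inv p , b

  ✶-! : ∀ x p y i → ((x , p) ✶ y) ! i ≡ (x ! i) · (y ! (K.inv p ∘ᴷ i))
  ✶-! x p y i = lookup∘tabulate _ i

  \\-cancel : ∀ p i → K.inv p ∘ᴷ (p ∘ᴷ i) ≡ i
  \\-cancel p i = trans (sym (K.assoc _ p i)) (trans (cong (_∘ᴷ i) (K.invˡ p)) (K.idˡ i))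

  ·-\\-cancel : ∀ p i → p ∘ᴷ (K.inv p ∘ᴷ i) ≡ i
  ·-\\-cancel p i = trans (sym (K.assoc p _ i)) (trans (cong (_∘ᴷ i) (K.invʳ p)) (K.idˡ i))

  inv-unique : ∀ {p i j} → p ∘ᴷ j ≡ i → K.inv p ∘ᴷ i ≡ j
  inv-unique {p} {j = j} refl = \\-cancel p j

  inv-∘ : ∀ p q i → K.inv (p ∘ᴷ q) ∘ᴷ i ≡ K.inv q ∘ᴷ (K.inv p ∘ᴷ i)
  inv-∘ p q i = inv-unique (trans (K.assoc p q _)
    (trans (cong (p ∘ᴷ_) (·-\\-cancel q _)) (·-\\-cancel p i)))

  isGroup : IsGroup _≡_ _∙_ ε _⁻¹
  isGroup = record
    { isMonoid = record
      { isSemigroup = record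
        { isMagma = record { isEquivalence = isEquivalence ; ∙-cong = cong₂ _∙_ }
        ; assoc   = λ (x , p , b) (y , q , c) (z , r , d) →
            cong₂ _,_ (vec-ext (λ i → begin
              (((x , p) ✶ y , p ∘ᴷ q) ✶ z) ! i
                ≡⟨ ✶-! ((x , p) ✶ y) (p ∘ᴷ q) z i ⟩
              (((x , p) ✶ y) ! i) · (z ! (K.inv (p ∘ᴷ q) ∘ᴷ i))
                ≡⟨ cong₂ _·_ (✶-! x p y i) (cong (z !_) (inv-∘ p q i)) ⟩
              ((x ! i) · (y ! (K.inv p ∘ᴷ i))) · (z ! (K.inv q ∘ᴷ (K.inv p ∘ᴷ i)))
                ≡⟨ H.assoc _ _ _ ⟩
              (x ! i) · ((y ! (K.inv p ∘ᴷ i)) · (z ! (K.inv q ∘ᴷ (K.inv p ∘ᴷ i))))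
                ≡⟨ cong ((x ! i) ·_) (✶-! y q z _) ⟨
              (x ! i) · (((y , q) ✶ z) ! (K.inv p ∘ᴷ i))
                ≡⟨ ✶-! x p ((y , q) ✶ z) i ⟨
              ((x , p) ✶ ((y , q) ✶ z)) ! i ∎))
            (cong₂ _,_ (K.assoc p q r) (xor-assoc b c d))
        }
      ; identity =
          (λ (x , p , b) → cong₂ _,_
            (vec-ext λ i → trans (✶-! ones K.e x i)
              (trans (cong₂ _·_ (lookup-replicate i H.e) (cong (x !_) (inv-unique (K.idˡ i)))) (H.idˡ _)))
            (cong (_, b) (K.idˡ p)))
        , (λ (x , p , b) → cong₂ _,_
            (vec-ext λ i → trans (✶-! x p ones i)
              (trans (cong ((x ! i) ·_) (lookup-replicate (K.inv p ∘ᴷ i) H.e)) (H.idʳ _)))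
            (cong₂ _,_ (K.idʳ p) (xor-identityʳ b)))
      }
    ; inverse =
        (λ (x , p , b) → cong₂ _,_
          (vec-ext λ i → trans (✶-! (shift⁻¹ x p) (K.inv p) x i)
            (trans (cong₂ _·_ (lookup∘tabulate (λ j → H.inv (x ! (p ∘ᴷ j))) i) (cong (x !_) (inv-unique (\\-cancel p i))))
            (trans (H.invˡ _) (sym (lookup-replicate i H.e)))))
          (cong₂ _,_ (K.invˡ p) (xor-same b)))
      , (λ (x , p , b) → cong₂ _,_
          (vec-ext λ i → trans (✶-! x p (shift⁻¹ x p) i)
            (trans (cong ((x ! i) ·_) (trans (lookup∘tabulate (λ j → H.inv (x ! (p ∘ᴷ j))) (K.inv p ∘ᴷ i))
              (cong (λ j → H.inv (x ! j)) (·-\\-cancel p i))))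
            (trans (H.invʳ _) (sym (lookup-replicate i H.e)))))
          (cong₂ _,_ (K.invʳ p) (xor-same b)))
    ; ⁻¹-cong = cong _⁻¹
    }
    where open ≡-Reasoning

  -- Generators, and paths that visit every coordinate

  single : Fin m → Vec (Fin m) n
  single h = ones [ K.e ]≔ h

  gen : Fin n → Fin m → Carrier
  gen s h = single h , s , true

  -- Translation by `p` carries the support of `single h` from the identity to `p`.
  ✶-single-here : ∀ x p h → ((x , p) ✶ single h) ! p ≡ (x ! p) · h
  ✶-single-here x p h = trans (✶-! x p (single h) p)
    (cong ((x ! p) ·_) (trans (cong (single h !_) (K.invˡ p)) (lookup∘update K.e ones h)))

  ✶-single-away : ∀ x p h i → i ≢ p → ((x , p) ✶ single h) ! i ≡ x ! i
  ✶-single-away x p h i i≢p = trans (✶-! x p (single h) i)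
    (trans (cong ((x ! i) ·_) (trans (lookup∘update′ away ones h) (lookup-replicate (K.inv p ∘ᴷ i) H.e))) (H.idʳ _))
    where
    away : K.inv p ∘ᴷ i ≢ K.e
    away eq = i≢p (trans (sym (·-\\-cancel p i)) (trans (cong (p ∘ᴷ_) eq) (K.idʳ p)))

  gen-injective : ∀ {s s′ h h′} → gen s h ≡ gen s′ h′ → s ≡ s′ × h ≡ h′
  gen-injective {h = h} {h′} eq = cong (proj₁ ∘ proj₂) eq ,
    trans (sym (lookup∘update K.e ones h)) (trans (cong ((_! K.e) ∘ proj₁) eq) (lookup∘update K.e ones h′))

  -- Associativity suffices, because `true xor parity ℓ` computes to `parity (suc ℓ)`.
  colour-step : ∀ b ℓ → (b xor true) xor parity ℓ ≡ b xor parity (suc ℓ)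
  colour-step b ℓ = xor-assoc b true (parity ℓ)

  module Moves (L : List Carrier) where

    open Transport carrier↔ isGroup public using (Path)

    -- Each step overwrites the current coordinate with its target value, which
    -- later steps at the same position leave unchanged.
    fill : ∀ y x p b (w : List (Fin n)) → All (λ s → ∀ h → gen s h List.∈ L) w →
      ∃[ x′ ] (Path L (length w) (x , p , b) (x′ , foldl _∘ᴷ_ p w , b xor parity (length w)) ×
               (∀ i → (x ! i ≡ y ! i) ⊎ i List.∈ visits _∘ᴷ_ p w → x′ ! i ≡ y ! i))
    fill y x p b []      []           =
      x , ([] , refl , [] , cong (λ c → x , p , c) (sym (xor-identityʳ b))) , λ { i (inj₁ eq) → eq }
    fill y x p b (s ∷ w) (s∈L ∷ w⊆L) =
      let h  = H.inv (x ! p) · (y ! p)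
          x₁ = (x , p) ✶ single h
          x′ , (gs , len , gs⊆L , eq) , agree = fill y x₁ (p ∘ᴷ s) (b xor true) w w⊆L
      in x′ , (gen s h ∷ gs , cong suc len , s∈L h ∷ gs⊆L ,
               trans eq (cong (λ c → x′ , _ , c) (colour-step b (length w)))) ,
         λ i i∈ → agree i (written i i∈)
      where
      here-agrees : ((x , p) ✶ single (H.inv (x ! p) · (y ! p))) ! p ≡ y ! p
      here-agrees = trans (✶-single-here x p _)
        (trans (sym (H.assoc _ _ _)) (trans (cong (_· (y ! p)) (H.invʳ (x ! p))) (H.idˡ (y ! p))))

      written : ∀ i → (x ! i ≡ y ! i) ⊎ i List.∈ visits _∘ᴷ_ p (s ∷ w) →
        (((x , p) ✶ single (H.inv (x ! p) · (y ! p))) ! i ≡ y ! i) ⊎ i List.∈ visits _∘ᴷ_ (p ∘ᴷ s) w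
      written i i∈ with i ≟ p | i∈
      ... | yes refl | _                = inj₁ here-agrees
      ... | no i≢p   | inj₁ eq          = inj₁ (trans (✶-single-away x p _ i i≢p) eq)
      ... | no i≢p   | inj₂ (here eq)   = contradiction eq i≢p
      ... | no _     | inj₂ (there i∈w) = inj₂ i∈w

    -- When every position is visited, the agreement in `fill` holds at all coordinates, so the
    -- vector reached is `y` itself.
    covering-path : ∀ x y p b (w : List (Fin n)) → All (λ s → ∀ h → gen s h List.∈ L) w →
      (∀ i → i List.∈ visits _∘ᴷ_ p w) →
      Path L (length w) (x , p , b) (y , foldl _∘ᴷ_ p w , b xor parity (length w))
    covering-path x y p b w w⊆L cov with fill y x p b w w⊆L
    ... | x′ , π , agree rewrite vec-ext {x = x′} {y} (λ i → agree i (inj₂ (cov i))) = π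

  -- Support size as a lower bound for path length

  weight : ∀ {r} → Vec (Fin m) r → ℕ
  weight = count (λ h → ¬? (h ≟ H.e))

  weight-ones : ∀ r → weight (Vec.replicate r H.e) ≡ 0
  weight-ones zero = refl
  weight-ones (suc r) with H.e ≟ H.e
  ... | yes _   = weight-ones r
  ... | no e≢e = contradiction refl e≢e

  weight-full : ∀ r {h} → h ≢ H.e → weight (Vec.replicate r h) ≡ r
  weight-full zero    h≢e = refl
  weight-full (suc r) {h} h≢e with h ≟ H.e
  ... | yes h≡e = contradiction h≡e h≢e
  ... | no _    = cong suc (weight-full r h≢e)

  weight-tail : ∀ {r} h (x : Vec (Fin m) r) → weight x ≤ weight (h ∷ x)
  weight-tail h x with h ≟ H.e
  ... | yes _ = ℕ.≤-refl
  ... | no _  = ℕ.n≤1+n _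

  weight-∷ : ∀ {r} h (x : Vec (Fin m) r) → weight (h ∷ x) ≤ suc (weight x)
  weight-∷ h x with h ≟ H.e
  ... | yes _ = ℕ.n≤1+n _
  ... | no _  = ℕ.≤-refl

  -- Coordinates other than `p` contribute equally to both weights, and `p` itself contributes at
  -- most one.
  weight-change : ∀ {r} (x y : Vec (Fin m) r) p → (∀ i → i ≢ p → y ! i ≡ x ! i) → weight y ≤ suc (weight x)
  weight-change (g ∷ x) (h ∷ y) zero    same
    rewrite vec-ext {x = y} {x} (λ i → same (suc i) λ ()) =
    ℕ.≤-trans (weight-∷ h x) (s≤s (weight-tail g x))
  weight-change (g ∷ x) (h ∷ y) (suc p) same rewrite same zero (λ ())
    with g ≟ H.e
  ... | yes _ = weight-change x y p λ i i≢p → same (suc i) (i≢p ∘ suc-injective)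
  ... | no _  = s≤s (weight-change x y p λ i i≢p → same (suc i) (i≢p ∘ suc-injective))

  -- The two invariants behind the lower bound on the diameter: a generator changes a single
  -- coordinate, and it always flips the colour.
  path-bounds : ∀ w x p b → All (λ g → ∃[ s ] ∃[ h ] g ≡ gen s h) w →
    let y , _ , c = foldl _∙_ (x , p , b) w in
    weight y ≤ length w + weight x × c ≡ b xor parity (length w)
  path-bounds []      x p b []                     = ℕ.≤-refl , sym (xor-identityʳ b)
  path-bounds (_ ∷ w) x p b ((s , h , refl) ∷ w⊆) =
    let x₁ = (x , p) ✶ single h
        wt , col = path-bounds w x₁ (p ∘ᴷ s) (b xor true) w⊆
    in ℕ.≤-trans wt (ℕ.≤-trans (ℕ.+-monoʳ-≤ (length w) (weight-change x x₁ p (✶-single-away x p h)))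
                               (ℕ.≤-reflexive (ℕ.+-suc (length w) (weight x))))
     , trans col (colour-step b (length w))

-- Tours of a cycle of even length by steps 1 and 2

visits-++ʳ : ∀ {A S : Set} (_∙_ : A → S → A) {p o} u {v a} → foldl _∙_ p u ≡ o →
  a List.∈ visits _∙_ o v → a List.∈ visits _∙_ p (u ++ v)
visits-++ʳ _∙_ []      refl a∈ = a∈
visits-++ʳ _∙_ (s ∷ u) eq   a∈ = there (visits-++ʳ _∙_ u eq a∈)

-- Allows tours to be built in ℕ, where positions grow without wrapping, and then carried to the
-- cycle.
visits-map : ∀ {A B S T : Set} {_∙_ : A → S → A} {_∘_ : B → T → B} {f : A → B} {g : S → T} →
  (∀ a s → f (a ∙ s) ≡ f a ∘ g s) → ∀ {x} a w →
  x List.∈ visits _∙_ a w → f x List.∈ visits _∘_ (f a) (map g w)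
visits-map             hom a (s ∷ w) (here refl) = here refl
visits-map {_∘_ = _∘_} {g = g} hom a (s ∷ w) (there x∈)  =
  there (subst (λ b → _ List.∈ visits _∘_ b (map g w)) (hom a s) (visits-map hom _ w x∈))

foldl-map-hom : ∀ {A B S T : Set} {_∙_ : A → S → A} {_∘_ : B → T → B} {f : A → B} {g : S → T} →
  (∀ a s → f (a ∙ s) ≡ f a ∘ g s) → ∀ a w → foldl _∘_ (f a) (map g w) ≡ f (foldl _∙_ a w)
foldl-map-hom hom a []      = refl
foldl-map-hom {_∘_ = _∘_} {g = g} hom a (s ∷ w) =
  trans (cong (λ b → foldl _∘_ b (map g w)) (sym (hom a s))) (foldl-map-hom hom _ w)

foldl-+-replicate : ∀ o c s → foldl _+_ o (replicate c s) ≡ o + c * s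
foldl-+-replicate o zero    s = sym (ℕ.+-identityʳ o)
foldl-+-replicate o (suc c) s = trans (foldl-+-replicate (o + s) c s) (ℕ.+-assoc o s (c * s))

-- The case `a = c` is the end of the run, which `visits` does not count for the run itself; it is
-- supplied by the hypothesis that `v` visits its own starting point.
visits-replicate : ∀ s c {v} → (∀ o → o List.∈ visits _+_ o v) →
  ∀ o a → a ≤ c → o + a * s List.∈ visits _+_ o (replicate c s ++ v)
visits-replicate s zero    {v} hd o zero    _         = subst (List._∈ visits _+_ o v) (sym (ℕ.+-identityʳ o)) (hd o)
visits-replicate s (suc c)     hd o zero    _         = here (ℕ.+-identityʳ o)
visits-replicate s (suc c) {v} hd o (suc a) (s≤s a≤c) =
  there (subst (List._∈ visits _+_ (o + s) (replicate c s ++ v)) (ℕ.+-assoc o s (a * s)) (visits-replicate s c hd (o + s) a a≤c))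

-- For n = 2(q + j + 1) the tour visits, modulo n, first 0, 2, …, 2q, then
-- 2q + 1, …, n − 1, and finally 1, 3, …, 2q − 1.
tour : ℕ → ℕ → ℕ → List ℕ
tour q j t = replicate q 2 ++ replicate (suc (j * 2)) 1 ++ replicate q 2 ++ t ∷ []

length-tour : ∀ q j t → length (tour q j t) ≡ (suc q + j) * 2
length-tour q j t
  rewrite length-++ (replicate q 2) {replicate (suc (j * 2)) 1 ++ replicate q 2 ++ t ∷ []}
        | length-++ (replicate (j * 2) 1) {replicate q 2 ++ t ∷ []}
        | length-++ (replicate q 2) {t ∷ []}
        | length-replicate q {2} | length-replicate (j * 2) {1} = arith q j
  where
  arith : ∀ q j → q + suc (j * 2 + (q + 1)) ≡ (suc q + j) * 2
  arith = solve-∀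

foldl-tour : ∀ q j ρ → foldl _+_ 0 (tour q j (suc ρ)) ≡ (suc q + j) * 2 + (ρ + q * 2)
foldl-tour q j ρ
  rewrite foldl-++ _+_ 0 (replicate q 2) (replicate (suc (j * 2)) 1 ++ replicate q 2 ++ suc ρ ∷ [])
        | foldl-+-replicate 0 q 2
        | foldl-++ _+_ (q * 2 + 1) (replicate (j * 2) 1) (replicate q 2 ++ suc ρ ∷ [])
        | foldl-+-replicate (q * 2 + 1) (j * 2) 1
        | foldl-++ _+_ (q * 2 + 1 + j * 2 * 1) (replicate q 2) (suc ρ ∷ [])
        | foldl-+-replicate (q * 2 + 1 + j * 2 * 1) q 2 = arith q j ρ
  where
  arith : ∀ q j ρ → q * 2 + 1 + j * 2 * 1 + q * 2 + suc ρ ≡ (suc q + j) * 2 + (ρ + q * 2)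
  arith = solve-∀

-- Write i = ρ + 2a. If a < q, an even i lies on the first run of double steps, and an odd i is met
-- as n + i on the last such run, after wrapping. If a ≥ q, the unit steps meet i.
tour-covers : ∀ q j t i → i < (suc q + j) * 2 →
  i List.∈ visits _+_ 0 (tour q j t) ⊎ (suc q + j) * 2 + i List.∈ visits _+_ 0 (tour q j t)
tour-covers q j t i i<n = go (i / 2) (i % 2) (m%n<n i 2) (m≡m%n+[m/n]*n i 2)
  where
  V = visits _+_ 0 (tour q j t)

  -- The case split only exposes the head of the list, which is `t` when `q` is zero.
  next : ∀ q o → o List.∈ visits _+_ o (replicate q 2 ++ t ∷ [])
  next zero    o = here refl
  next (suc q) o = here refl

  first : ∀ a → a ≤ q → a * 2 List.∈ V
  first a a≤q = visits-replicate 2 q (λ _ → here refl) 0 a a≤q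

  second : ∀ b → b ≤ suc (j * 2) → q * 2 + b * 1 List.∈ V
  second b b≤ = visits-++ʳ _+_ (replicate q 2) (foldl-+-replicate 0 q 2)
    (visits-replicate 1 (suc (j * 2)) (next q) (q * 2) b b≤)

  third : ∀ a → a ≤ q → q * 2 + suc (j * 2) * 1 + a * 2 List.∈ V
  third a a≤q = visits-++ʳ _+_ (replicate q 2) (foldl-+-replicate 0 q 2)
    (visits-++ʳ _+_ (replicate (suc (j * 2)) 1) (foldl-+-replicate (q * 2) (suc (j * 2)) 1)
      (visits-replicate 2 q (λ _ → here refl) _ a a≤q))

  arith : ∀ q j a → q * 2 + suc (j * 2) * 1 + suc a * 2 ≡ (suc q + j) * 2 + (1 + a * 2)
  arith = solve-∀

  arith′ : ∀ q j → suc ((q + j) * 2) ≡ q * 2 + suc (j * 2)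
  arith′ = solve-∀

  go : ∀ a ρ → ρ < 2 → i ≡ ρ + a * 2 → i List.∈ V ⊎ (suc q + j) * 2 + i List.∈ V
  go a ρ ρ<2 i≡ with a <? q
  go a 0 _ refl | yes a<q = inj₁ (first a (ℕ.<⇒≤ a<q))
  -- The last run starts at n - 1, so a + 1 double steps lead to n + (1 + 2a).
  go a 1 _ refl | yes a<q = inj₂ (subst (List._∈ V) (arith q j a) (third (suc a) a<q))
  go a (suc (suc _)) (s≤s (s≤s ())) _ | yes _
  -- The unit run starts at 2q and 2j + 1 steps take it to n - 1, so i is reached after i - 2q of
  -- them.
  go a ρ _ i≡ | no a≮q = inj₁ (subst (List._∈ V)
      (trans (cong (q * 2 +_) (ℕ.*-identityʳ _)) (ℕ.m+[n∸m]≡n q2≤i))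
      (second (i ∸ q * 2) (ℕ.m≤n+o⇒m∸n≤o i (q * 2) (ℕ.≤-trans (s≤s⁻¹ i<n) (ℕ.≤-reflexive (arith′ q j))))))
    where
    q2≤i : q * 2 ≤ i
    q2≤i = ℕ.≤-trans (ℕ.*-monoˡ-≤ 2 (ℕ.≮⇒≥ a≮q)) (ℕ.≤-trans (ℕ.m≤n+m (a * 2) ρ) (ℕ.≤-reflexive (sym i≡)))

tour-exists : ∀ h r → r < h * 2 → ∃[ w ] (length w ≡ h * 2 × All (λ s → s ≡ 1 ⊎ s ≡ 2) w ×
  foldl _+_ 0 w ≡ h * 2 + r ×
  (∀ i → i < h * 2 → i List.∈ visits _+_ 0 w ⊎ h * 2 + i List.∈ visits _+_ 0 w))
-- Halving `r` gives `q` and `ρ`; since r < 2h, the quotient is below `h`, and `j` is the gap in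
-- `suc q + j ≡ h`.
tour-exists h r r<n = go h (r / 2) (r % 2) (m%n<n r 2) (m≡m%n+[m/n]*n r 2)
  (proj₂ (ℕ.m≤n⇒∃[o]m+o≡n (m<n*o⇒m/o<n r<n)))
  where
  go : ∀ h {r} q ρ {j} → ρ < 2 → r ≡ ρ + q * 2 → suc q + j ≡ h →
    ∃[ w ] (length w ≡ h * 2 × All (λ s → s ≡ 1 ⊎ s ≡ 2) w × foldl _+_ 0 w ≡ h * 2 + r ×
      (∀ i → i < h * 2 → i List.∈ visits _+_ 0 w ⊎ h * 2 + i List.∈ visits _+_ 0 w))
  go _ q ρ {j} ρ<2 refl refl = tour q j (suc ρ) , length-tour q j (suc ρ) ,
    All.++⁺ twos (All.++⁺ (All.replicate⁺ (suc (j * 2)) (inj₁ refl)) (All.++⁺ twos (last ρ ρ<2 ∷ []))) ,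
    foldl-tour q j ρ , tour-covers q j (suc ρ)
    where
    twos : All (λ s → s ≡ 1 ⊎ s ≡ 2) (replicate q 2)
    twos = All.replicate⁺ q (inj₂ refl)

    last : ∀ ρ → ρ < 2 → suc ρ ≡ 1 ⊎ suc ρ ≡ 2
    last 0 _ = inj₁ refl
    last 1 _ = inj₂ refl
    last (suc (suc _)) (s≤s (s≤s ()))

-- A tour of ℕ is translated by `p` through `at`, with the offset of `q` from `p` as its end offset.
-- The surplus n, at the end and at wrapped positions, vanishes modulo n.
cyclic-tour : ∀ h .{{_ : NonZero (h * 2)}} (p q : Fin (h * 2)) → let _⊞_ = _⊕_ (h * 2) in
  ∃[ w ] (length w ≡ h * 2 × All (λ s → s ≡ 1 mod (h * 2) ⊎ s ≡ 2 mod (h * 2)) w ×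
    foldl _⊞_ p w ≡ q × (∀ i → i List.∈ visits _⊞_ p w))
cyclic-tour h p q with tour-exists h (toℕ (FinGroup.inv (cyclic (h * 2)) p ⊞ q)) (toℕ<n _)
  where _⊞_ = _⊕_ (h * 2)
... | w , len , steps , end , cov =
  map (_mod n) w , trans (length-map _ w) len , All.map⁺ (All.map [ inj₁ ∘ cong (_mod n) , inj₂ ∘ cong (_mod n) ]′ steps) ,
  trans (cong (λ a → foldl _⊞_ a (map (_mod n) w)) (sym at-0))
    (trans (foldl-map-hom at-+ 0 w) (trans (cong at end) (trans (at-n _) (at-offset q)))) ,
  λ i → subst (λ a → i List.∈ visits _⊞_ a (map (_mod n) w)) at-0
    ([ (λ o∈ → subst (List._∈ _) (at-offset i) (visits-map at-+ 0 w o∈))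
     , (λ o∈ → subst (List._∈ _) (trans (at-n _) (at-offset i)) (visits-map at-+ 0 w o∈)) ]′
     (cov (toℕ (inv p ⊞ i)) (toℕ<n _)))
  where
  n = h * 2
  open FinGroup (cyclic n) using (inv; assoc; idˡ; idʳ; invʳ)
  _⊞_ = _⊕_ n

  at : ℕ → Fin n
  at o = p ⊞ (o mod n)

  at-0 : at 0 ≡ p
  at-0 = idʳ p

  at-+ : ∀ a s → at (a + s) ≡ at a ⊞ (s mod n)
  at-+ a s = trans (cong (p ⊞_) (sym (mod-⊕ n a s))) (sym (assoc p (a mod n) (s mod n)))

  at-n : ∀ o → at (n + o) ≡ at o
  at-n o = cong (p ⊞_) (mod-cong n (trans (cong (_% n) (ℕ.+-comm n o)) ([m+n]%n≡m%n o n)))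

  at-offset : ∀ i → at (toℕ (inv p ⊞ i)) ≡ i
  at-offset i = trans (cong (p ⊞_) (toℕ-mod _))
    (trans (sym (assoc p (inv p) i)) (trans (cong (_⊞ i) (invʳ p)) (idˡ i)))

-- The Cayley digraphs of degree 2m and 2m + 1

parity-even : ∀ h → parity (h * 2) ≡ false
parity-even zero    = refl
parity-even (suc h) = trans (not-involutive _) (parity-even h)

mod-injective : ∀ {n} .{{_ : NonZero n}} {a b} → a < n → b < n → a mod n ≡ b mod n → a ≡ b
mod-injective {n} {a} {b} a<n b<n eq = begin
  a              ≡⟨ m<n⇒m%n≡m a<n ⟨
  a % n          ≡⟨ toℕ-fromℕ< (m%n<n a n) ⟨
  toℕ (a mod n)  ≡⟨ cong toℕ eq ⟩
  toℕ (b mod n)  ≡⟨ toℕ-fromℕ< (m%n<n b n) ⟩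
  b % n          ≡⟨ m<n⇒m%n≡m b<n ⟩
  b              ∎
  where open ≡-Reasoning

-- Having m ≥ 2 gives ℤ_m a nonzero element for the far vertex; having h ≥ 2 gives n ≥ 4, so that
-- the shifts 0, 1 and 2 are distinct modulo n.
module Construction (m′ h′ : ℕ) where

  m h n : ℕ
  m = suc (suc m′)
  h = suc (suc h′)
  n = h * 2

  private
    module H = FinGroup (cyclic m)

  open Wreath (cyclic m) (cyclic n)

  order : 2 * n * m ^ n ≤ m ^ n * (n * 2)
  order = ℕ.≤-reflexive (trans (ℕ.*-comm (2 * n) (m ^ n)) (cong (m ^ n *_) (ℕ.*-comm 2 n)))

  -- Keeping `L` abstract serves both parities of the degree: tours need all generators of shifts 1
  -- and 2, while the lower bound and the colouring only need every element to have the form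
  -- `gen s a`.
  module _ (L : List Carrier)
    (gen₁∈L : ∀ a → gen (1 mod n) a List.∈ L) (gen₂∈L : ∀ a → gen (2 mod n) a List.∈ L)
    (L⊆gen : ∀ {g} → g List.∈ L → ∃[ s ] ∃[ a ] g ≡ gen s a) where

    open Moves L

    -- A tour has the even length n = 2h, so its colour flips cancel.
    same-colour : ∀ x p b y q → Path L n (x , p , b) (y , q , b)
    same-colour x p b y q =
      let w , len , steps , end , cov = cyclic-tour h p q
          gs , len′ , gs⊆L , eq = covering-path x y p b w
            (All.map [ (λ { refl → gen₁∈L }) , (λ { refl → gen₂∈L }) ]′ steps) cov
      in gs , trans len′ len , gs⊆L , trans eq (cong₂ (λ r c → y , r , c) end
           (trans (cong (λ ℓ → b xor parity ℓ) len) (trans (cong (b xor_) (parity-even h)) (xor-identityʳ b))))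

    near : ∀ u v → ∃[ ℓ ] (ℓ ≤ suc n × Path L ℓ u v)
    near (x , p , b) (y , q , c) with b ≟ᵇ c
    ... | yes refl = n , ℕ.n≤1+n n , same-colour x p b y q
    ... | no b≢c   =
      -- One initial step corrects the colour, and a tour from its endpoint does the rest.
      let g = gen (1 mod n) H.e
          x₁ , p₁ , b₁ = (x , p , b) ∙ g
          gs , len , gs⊆L , eq = same-colour x₁ p₁ b₁ y q
      in suc n , ℕ.≤-refl , g ∷ gs , cong suc len , gen₁∈L H.e ∷ gs⊆L ,
         trans eq (cong (λ d → y , q , d) (flip b c b≢c))
      where
      flip : ∀ b c → b ≢ c → b xor true ≡ c
      flip true  true  b≢c = contradiction refl b≢c
      flip true  false _   = refl
      flip false true  _   = refl
      flip false false b≢c = contradiction refl b≢c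

    -- A vector of full support needs n steps, and its colour forces their number to be odd.
    far : ∀ ℓ → ℓ ≤ n → ¬ Path L ℓ ε (Vec.replicate n (1 mod m) , 0 mod n , true)
    far ℓ ℓ≤n (w , refl , w⊆L , eq) = contradiction
      (trans (cong (proj₂ ∘ proj₂) (sym eq))
        (trans (proj₂ bounds) (trans (cong parity (ℕ.≤-antisym ℓ≤n n≤ℓ)) (parity-even h))))
      λ ()
      where
      bounds = path-bounds w ones (0 mod n) false (All.map L⊆gen w⊆L)

      1≢e : 1 mod m ≢ H.e
      1≢e eq = contradiction (mod-injective {m} (s≤s (s≤s z≤n)) (s≤s z≤n) eq) λ ()

      n≤ℓ : n ≤ length w
      n≤ℓ = begin
        n                                       ≡⟨ weight-full n 1≢e ⟨
        weight (Vec.replicate n (1 mod m))      ≡⟨ cong (weight ∘ proj₁) eq ⟨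
        weight (proj₁ (foldl _∙_ ε w))          ≤⟨ proj₁ bounds ⟩
        length w + weight ones                  ≡⟨ cong (length w +_) (weight-ones n) ⟩
        length w + 0                            ≡⟨ ℕ.+-identityʳ _ ⟩
        length w                                ∎
        where open ℕ.≤-Reasoning

    alternates : ∀ u {g} → g List.∈ L → proj₂ (proj₂ u) ≢ proj₂ (proj₂ (u ∙ g))
    alternates (_ , _ , b) g∈L eq with L⊆gen g∈L
    alternates (_ , _ , true)  g∈L () | _ , _ , refl
    alternates (_ , _ , false) g∈L () | _ , _ , refl

    bc : Unique L → BC≥ (length L) (suc n) (2 * n * m ^ n)
    bc L! = m ^ n * (n * 2) , Transport.finGroup carrier↔ isGroup , Transport.X carrier↔ isGroup L ,
      Transport.isBipCayley carrier↔ isGroup L L! (proj₂ ∘ proj₂) alternates near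
        (ε , (Vec.replicate n (1 mod m) , 0 mod n , true) , far) ,
      order

  row : ℕ → List Carrier
  row s = map (gen (s mod n)) (allFin m)

  row-unique : ∀ s → Unique (row s)
  row-unique s = Unique.map⁺ (proj₂ ∘ gen-injective) (Unique.allFin⁺ m)

  ∈-row⁻ : ∀ s {g} → g List.∈ row s → ∃[ a ] g ≡ gen (s mod n) a
  ∈-row⁻ s g∈ with ∈-map⁻ (gen (s mod n)) g∈
  ... | a , _ , eq = a , eq

  ∈-row⁺ : ∀ s a → gen (s mod n) a List.∈ row s
  ∈-row⁺ s a = ∈-map⁺ (gen (s mod n)) (∈-allFin a)

  shift-distinct : ∀ {s t a b} → s < 3 → t < 3 → s ≢ t → gen (s mod n) a ≢ gen (t mod n) b
  shift-distinct s<3 t<3 s≢t eq = s≢t (mod-injective {n} (3≤n s<3) (3≤n t<3) (proj₁ (gen-injective eq)))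
    where
    3≤n : ∀ {s} → s < 3 → s < n
    3≤n s<3 = ℕ.≤-trans s<3 (s≤s (s≤s (s≤s z≤n)))

  rows : List Carrier
  rows = row 1 ++ row 2

  rows-unique : Unique rows
  rows-unique = Unique.++⁺ (row-unique 1) (row-unique 2) λ (g∈₁ , g∈₂) → disjoint (∈-row⁻ 1 g∈₁) (∈-row⁻ 2 g∈₂)
    where
    disjoint : ∀ {g} → ∃[ a ] g ≡ gen (1 mod n) a → ¬ (∃[ a ] g ≡ gen (2 mod n) a)
    disjoint (_ , refl) (_ , eq) = shift-distinct (s≤s (s≤s z≤n)) (s≤s (s≤s (s≤s z≤n))) (λ ()) eq

  length-rows : length rows ≡ m + m
  length-rows = trans (length-++ (row 1)) (cong₂ _+_ (length-row 1) (length-row 2))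
    where
    length-row : ∀ s → length (row s) ≡ m
    length-row s = trans (length-map _ (allFin m)) (length-tabulate id)

  ∈-rows⁻ : ∀ {g} → g List.∈ rows → ∃[ s ] (s < 3 × s ≢ 0 × ∃[ a ] g ≡ gen (s mod n) a)
  ∈-rows⁻ g∈ with ∈-++⁻ (row 1) g∈
  ... | inj₁ g∈₁ = 1 , s≤s (s≤s z≤n) , (λ ()) , ∈-row⁻ 1 g∈₁
  ... | inj₂ g∈₂ = 2 , s≤s (s≤s (s≤s z≤n)) , (λ ()) , ∈-row⁻ 2 g∈₂

  rows⊆gen : ∀ {g} → g List.∈ rows → ∃[ s ] ∃[ a ] g ≡ gen s a
  rows⊆gen g∈ = let s , _ , _ , a , eq = ∈-rows⁻ g∈ in s mod n , a , eq

  bc-even : BC≥ (m + m) (suc n) (2 * n * m ^ n)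
  bc-even = subst (λ d → BC≥ d (suc n) (2 * n * m ^ n)) length-rows
    (bc rows (∈-++⁺ˡ ∘ ∈-row⁺ 1) (∈-++⁺ʳ (row 1) ∘ ∈-row⁺ 2) rows⊆gen rows-unique)

  bc-odd : BC≥ (suc (m + m)) (suc n) (2 * n * m ^ n)
  bc-odd = subst (λ d → BC≥ (suc d) (suc n) (2 * n * m ^ n)) length-rows
    (bc (extra ∷ rows) (there ∘ ∈-++⁺ˡ ∘ ∈-row⁺ 1) (there ∘ ∈-++⁺ʳ (row 1) ∘ ∈-row⁺ 2)
      (λ { (here refl) → 0 mod n , H.e , refl ; (there g∈) → rows⊆gen g∈ })
      (All.tabulate extra∉ ∷ rows-unique))
    where
    -- Its shift 0 sets it apart from both rows, and its colour bit keeps the digraph bipartite.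
    extra = gen (0 mod n) H.e

    extra∉ : ∀ {g} → g List.∈ rows → extra ≢ g
    extra∉ g∈ eq with ∈-rows⁻ g∈
    ... | s , s<3 , s≢0 , a , refl = shift-distinct (s≤s z≤n) s<3 (s≢0 ∘ sym) eq

-- The degree hypothesis and the final bound

2*j<3^j : ∀ j → 2 * j < 3 ^ j
2*j<3^j zero    = s≤s z≤n
2*j<3^j (suc j) = begin-strict
  2 * suc j            ≡⟨ ℕ.*-suc 2 j ⟩
  2 + 2 * j            <⟨ ℕ.+-monoʳ-< 2 (2*j<3^j j) ⟩
  2 + 3 ^ j            ≤⟨ ℕ.+-monoˡ-≤ (3 ^ j) (ℕ.*-monoʳ-≤ 2 (ℕ.m^n>0 3 j)) ⟩
  2 * 3 ^ j + 3 ^ j    ≡⟨ ℕ.+-comm (2 * 3 ^ j) (3 ^ j) ⟩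
  3 * 3 ^ j            ∎
  where open ℕ.≤-Reasoning

-- For d ≤ 3 the right-hand side of the hypothesis is at most 2n, which is below 3^n. The conclusion
-- yields ⌊d/2⌋ ≥ 2.
degree≥4 : ∀ n d → 3 ^ n ≤ n * (d ∸ 1) → 4 ≤ d
degree≥4 n d hyp with 3 <? d
... | yes 3<d = 3<d
... | no  3≮d = contradiction (ℕ.≤-trans hyp (begin
  n * (d ∸ 1)  ≤⟨ ℕ.*-monoʳ-≤ n (ℕ.∸-monoˡ-≤ 1 (ℕ.≮⇒≥ 3≮d)) ⟩
  n * 2        ≡⟨ ℕ.*-comm n 2 ⟩
  2 * n        ∎)) (ℕ.<⇒≱ (2*j<3^j n))
  where open ℕ.≤-Reasoning

halves : ∀ d → d ≡ ⌊ d /2⌋ + ⌊ d /2⌋ ⊎ d ≡ suc (⌊ d /2⌋ + ⌊ d /2⌋)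
halves zero          = inj₁ refl
halves (suc zero)    = inj₂ refl
halves (suc (suc d)) rewrite ℕ.+-suc ⌊ d /2⌋ ⌊ d /2⌋ with halves d
... | inj₁ eq = inj₁ (cong (2 +_) eq)
... | inj₂ eq = inj₂ (cong (2 +_) eq)

bc-construction : ∀ {k h m d} → k ≡ suc (h * 2) → 5 ≤ k → 2 ≤ m → d ≡ m + m ⊎ d ≡ suc (m + m) →
  BC≥ d k (2 * (k ∸ 1) * m ^ (k ∸ 1))
-- The values h = 0 and h = 1 would give k = 1 and k = 3, contrary to 5 ≤ k.
bc-construction {h = 0} refl (s≤s ())             _ _
bc-construction {h = 1} refl (s≤s (s≤s (s≤s ()))) _ _
bc-construction {h = suc (suc h)} {suc (suc m)} refl _ _ (inj₁ refl) = Construction.bc-even m h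
bc-construction {h = suc (suc h)} {suc (suc m)} refl _ _ (inj₂ refl) = Construction.bc-odd m h
bc-construction {m = 1} refl _ (s≤s ()) _

-- The bound on `d` is stated with its denominator k - 1 cleared. Truncated subtraction is harmless:
-- d = 0 would make the right-hand side 0, below any power of 3.
mainTheorem13 : (k d : ℕ) → 5 ≤ k → k % 2 ≡ 1 →
    3 ^ (k ∸ 1) ≤ (k ∸ 1) * (d ∸ 1) →
    BC≥ d k (2 * (k ∸ 1) * ⌊ d /2⌋ ^ (k ∸ 1))
mainTheorem13 k d 5≤k k-odd hyp = bc-construction {h = k / 2}
  (trans (m≡m%n+[m/n]*n k 2) (cong (_+ k / 2 * 2) k-odd)) 5≤k
  (ℕ.⌊n/2⌋-mono (degree≥4 (k ∸ 1) d hyp)) (halves d)
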